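{- Let $\mathcal{G}=(V,E,\lambda)$ be a happy compressed temporal graph with $n=|V|\ge 2$ vertices that is temporally connected and minimal. Let $k$ be the number of divergent edges of $\mathcal{G}$. Then the lower part of $\mathcal{G}$ (the static graph on $V$ whose edges are the source edges) is a forest consisting of $k$ disjoint trees with $n-k$ edges in total. Likewise, if $k'$ is the number of convergent edges of $\mathcal{G}$, then the upper part of $\mathcal{G}$ (the static graph on $V$ whose edges are the div-sink edges) is a forest consisting of $k'$ disjoint trees with $n-k'$ edges in total.
   Context: A happy temporal graph is a triple $\mathcal{G}=(V,E,\lambda)$ where $(V,E)$ is a finite simple undirected graph (the footprint) and $\lambda:E\to\{1,2,3,\dots\}$ assigns a single time label to each edge, such that two distinct edges sharing an endpoint have different labels. It is compressed if for every edge $e$ with $\lambda(e)>1$ there is an edge $e'$ adjacent to $e$ with $\lambda(e')=\lambda(e)-1$. A temporal walk is a walk in the footprint along which edge labels are strictly increasing (so no edge is repeated); the empty walk is allowed. For vertices $u,v$ and edges $e,e'$: $u\leadsto v$ means there is a temporal walk from $u$ to $v$; $v\leadsto e$ means some temporal walk starts at $v$ and traverses $e$; $e\leadsto v$ means some temporal walk traverses $e$ and ends at $v$; $e\leadsto e'$ means some temporal walk traverses $e$ and $e'$ in this order, not necessarily consecutively (with $e\leadsto e$ always). Edges may be traversed in either direction. $\mathcal{G}$ is temporally connected if $u\leadsto v$ for all $u,v\in V$. The reachability graph $\mathcal{R}(\mathcal{G})$ is the directed graph on $V$ with arcs $(u,v)$ whenever $u\leadsto v$; $\mathcal{G}$ is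 minimal if $\mathcal{R}(\mathcal{G}\setminus\{e\})\ne\mathcal{R}(\mathcal{G})$ for every $e\in E$ (deleting $e$, keeping all vertices and the other labelled edges). An edge $e$ is a source edge if $e\leadsto v$ for all $v\in V$, and a sink edge if $v\leadsto e$ for all $v\in V$. A divergent edge is a source edge $e$ such that there is no other source edge $e'\neq e$ with $e\leadsto e'$. A div-sink edge is a sink edge $e$ such that $d\leadsto e$ for every divergent edge $d$. A convergent edge is a div-sink edge $e$ such that there is no other div-sink edge $e'\ne e$ with $e'\leadsto e$. -}

module Defs where

open import Data.Fin using (Fin; zero; suc)
open import Data.Fin.Properties using (_≟_; any?; all?; injective⇒≤)
open import Data.List using (List; []; _∷_; length; lookup; filter; allFin)
open import Data.List.Membership.DecPropositional using () renaming (_∈?_ to mem?)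
open import Data.List.Membership.Propositional using (_∈_)
open import Data.List.Membership.Propositional.Properties using (∈-lookup)
open import Data.List.Relation.Binary.Sublist.DecPropositional using () renaming (_⊆?_ to sublist?)
open import Data.List.Relation.Binary.Sublist.Propositional using (_⊆_)
open import Data.List.Relation.Unary.All as All using (All)
open import Data.List.Relation.Unary.AllPairs as AllPairs using (_∷_)
open import Data.List.Relation.Unary.Linked using (Linked; linked?)
open import Data.List.Relation.Unary.Linked.Properties using (Linked⇒AllPairs)
open import Data.List.Relation.Unary.Unique.Propositional using (Unique)
open import Data.Nat using (ℕ; zero; suc; _<_; _≤_; _<?_; s≤s⁻¹)
open import Data.Nat.Properties using (<-trans; <⇒≢)
open import Data.Product using (Σ-syntax; ∃; ∃-syntax; _×_; _,_)
open import Data.Product.Properties using (≡-dec)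
open import Data.Sum using (_⊎_; inj₁; inj₂)
open import Function using (_∘_)
open import Function.Definitions using (Surjective)
open import Level using (0ℓ)
open import Relation.Binary using (Rel)
open import Relation.Binary.PropositionalEquality using (_≡_; _≢_; refl; sym; cong)
open import Relation.Nullary using (Dec; ¬_; contradiction)
open import Relation.Nullary.Decidable using (map′; _×-dec_; _⊎-dec_; _→-dec_; ¬?)
open import Relation.Unary using (Pred; Decidable; U)
import Function.Bundles as Fun
import Relation.Binary as Bin

-- The vertex set is Fin n and the edges are named by Fin m.  The orientation
-- in which `ends` lists the two endpoints of an edge carries no meaning.
record HappyTemporalGraph (n : ℕ) : Set where
  V : Set
  V = Fin n

  field
    m    : ℕ
    ends : Fin m → V × V

  Edge : Set
  Edge = Fin m

  Joins : Edge → V → V → Set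
  Joins e u v = ends e ≡ (u , v) ⊎ ends e ≡ (v , u)

  -- Distinct edges sharing an endpoint.
  Adjacent : Edge → Edge → Set
  Adjacent e e′ = e ≢ e′ × ∃[ v ] ∃[ u ] ∃[ w ] (Joins e v u × Joins e′ v w)

  field
    loopless : ∀ e v → ¬ Joins e v v
    simple   : ∀ e e′ u v → Joins e u v → Joins e′ u v → e ≡ e′
    label    : Edge → ℕ
    positive : ∀ e → 1 ≤ label e
    happy    : ∀ e e′ → Adjacent e e′ → label e ≢ label e′

module _ {n : ℕ} (G : HappyTemporalGraph n) where
  open HappyTemporalGraph G

  Compressed : Set
  Compressed = ∀ e → 1 < label e → ∃[ e′ ] (Adjacent e e′ × suc (label e′) ≡ label e)

  data Walk : V → List Edge → V → Set where
    []  : ∀ {u} → Walk u [] u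
    _∷_ : ∀ {u v w e es} → Joins e u v → Walk v es w → Walk u (e ∷ es) w

  Increasing : List Edge → Set
  Increasing = Linked (λ e e′ → label e < label e′)

  TemporalWalk : V → List Edge → V → Set
  TemporalWalk u es v = Walk u es v × Increasing es

  -- A spanning subgraph (all vertices, labels inherited) is given by the
  -- predicate selecting its edges; 𝓡 F is its reachability graph.
  𝓡 : Pred Edge 0ℓ → Rel V 0ℓ
  𝓡 F u v = ∃[ es ] (TemporalWalk u es v × All F es)

  TemporallyConnected : Set
  TemporallyConnected = ∀ u v → 𝓡 U u v

  delete : Edge → Pred Edge 0ℓ
  delete e e′ = e′ ≢ e

  Minimal : Set
  Minimal = ∀ e → ¬ (𝓡 (delete e) Bin.⇔ 𝓡 U)

  infix 4 _ᵛ⇝ᵉ_ _ᵉ⇝ᵛ_ _ᵉ⇝ᵉ_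

  _ᵛ⇝ᵉ_ : V → Edge → Set
  v ᵛ⇝ᵉ e = ∃[ es ] ∃[ w ] (TemporalWalk v es w × e ∈ es)

  _ᵉ⇝ᵛ_ : Edge → V → Set
  e ᵉ⇝ᵛ v = ∃[ es ] ∃[ u ] (TemporalWalk u es v × e ∈ es)

  -- _⊆_ on lists is the (order-preserving) sublist relation.
  _ᵉ⇝ᵉ_ : Edge → Edge → Set
  e ᵉ⇝ᵉ e′ = e ≡ e′ ⊎
    ∃[ es ] ∃[ u ] ∃[ w ] (TemporalWalk u es w × (e ∷ e′ ∷ []) ⊆ es)

  Source : Pred Edge 0ℓ
  Source e = ∀ v → e ᵉ⇝ᵛ v

  Sink : Pred Edge 0ℓ
  Sink e = ∀ v → v ᵛ⇝ᵉ e

  Divergent : Pred Edge 0ℓ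
  Divergent e = Source e × ¬ (∃[ e′ ] (Source e′ × e′ ≢ e × e ᵉ⇝ᵉ e′))

  DivSink : Pred Edge 0ℓ
  DivSink e = Sink e × (∀ d → Divergent d → d ᵉ⇝ᵉ e)

  Convergent : Pred Edge 0ℓ
  Convergent e = DivSink e × ¬ (∃[ e′ ] (DivSink e′ × e′ ≢ e × e′ ᵉ⇝ᵉ e))

  Connected : Pred Edge 0ℓ → Rel V 0ℓ
  Connected F u v = ∃[ es ] (Walk u es v × All F es)

  arrivals : ∀ {u es v} → Walk u es v → List V
  arrivals []                = []
  arrivals (_∷_ {v = v} _ w) = v ∷ arrivals w

  Cycle : Pred Edge 0ℓ → Set
  Cycle F = ∃[ u ] ∃[ es ] Σ[ w ∈ Walk u es u ]
    (3 ≤ length es × Unique (arrivals w) × All F es)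

  -- The trees of a forest are its connected components (an isolated vertex
  -- being a one-vertex tree); `tree` names the component of each vertex.
  record IsForestOfTrees (F : Pred Edge 0ℓ) (k : ℕ) : Set where
    field
      acyclic         : ¬ Cycle F
      tree            : V → Fin k
      tree-surjective : Surjective _≡_ _≡_ tree
      tree-component  : ∀ u v → (tree u ≡ tree v) Fun.⇔ Connected F u v

  -- The number of edges satisfying a decidable predicate.
  # : {P : Pred Edge 0ℓ} → Decidable P → ℕ
  # P? = length (filter P? (allFin m))

  -- Decidability of the above predicates, needed for counting: a temporal walk
  -- repeats no edge, so only edge lists of length at most m have to be searched.

  boundedList? : ∀ b {P : Pred (List Edge) 0ℓ} → Decidable P →
                 (∀ {es} → P es → length es ≤ b) → Dec (∃ P)
  boundedList? zero P? bd =
    map′ ([] ,_) (λ { ([] , p) → p ; (_ ∷ _ , p) → contradiction (bd p) λ () }) (P? [])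
  boundedList? (suc b) P? bd =
    map′ (λ { (inj₁ p) → [] , p ; (inj₂ (e , es , p)) → e ∷ es , p })
         (λ { ([] , p) → inj₁ p ; (e ∷ es , p) → inj₂ (e , es , p) })
         (P? [] ⊎-dec any? λ e → boundedList? b (P? ∘ (e ∷_)) (s≤s⁻¹ ∘ bd))

  unique⇒lookup-injective : {es : List Edge} → Unique es →
                            ∀ i j → lookup es i ≡ lookup es j → i ≡ j
  unique⇒lookup-injective (_  ∷ _)  zero    zero    _  = refl
  unique⇒lookup-injective (px ∷ _)  zero    (suc j) eq =
    contradiction eq (All.lookup px (∈-lookup j))
  unique⇒lookup-injective (px ∷ _)  (suc i) zero    eq =
    contradiction (sym eq) (All.lookup px (∈-lookup i))
  unique⇒lookup-injective (_  ∷ pu) (suc i) (suc j) eq =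
    cong suc (unique⇒lookup-injective pu i j eq)

  increasing⇒length≤m : ∀ {es} → Increasing es → length es ≤ m
  increasing⇒length≤m inc = injective⇒≤ λ {i} {j} → unique⇒lookup-injective
    (AllPairs.map (λ l<l′ → <⇒≢ l<l′ ∘ cong label) (Linked⇒AllPairs <-trans inc)) i j

  joins? : ∀ e u v → Dec (Joins e u v)
  joins? e u v = ≡-dec _≟_ _≟_ (ends e) (u , v) ⊎-dec ≡-dec _≟_ _≟_ (ends e) (v , u)

  walk? : ∀ u es v → Dec (Walk u es v)
  walk? u [] v = map′ (λ { refl → [] }) (λ { [] → refl }) (u ≟ v)
  walk? u (e ∷ es) v =
    map′ (λ { (_ , j , w) → j ∷ w }) (λ { (j ∷ w) → _ , j , w })
         (any? λ x → joins? e u x ×-dec walk? x es v)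

  temporalWalk? : ∀ u es v → Dec (TemporalWalk u es v)
  temporalWalk? u es v = walk? u es v ×-dec linked? (λ e e′ → label e <? label e′) es

  ᵛ⇝ᵉ? : ∀ v e → Dec (v ᵛ⇝ᵉ e)
  ᵛ⇝ᵉ? v e = boundedList? m
    (λ es → any? λ w → temporalWalk? v es w ×-dec mem? _≟_ e es)
    (λ { (_ , (_ , inc) , _) → increasing⇒length≤m inc })

  ᵉ⇝ᵛ? : ∀ e v → Dec (e ᵉ⇝ᵛ v)
  ᵉ⇝ᵛ? e v = boundedList? m
    (λ es → any? λ u → temporalWalk? u es v ×-dec mem? _≟_ e es)
    (λ { (_ , (_ , inc) , _) → increasing⇒length≤m inc })

  ᵉ⇝ᵉ? : ∀ e e′ → Dec (e ᵉ⇝ᵉ e′)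
  ᵉ⇝ᵉ? e e′ = e ≟ e′ ⊎-dec boundedList? m
    (λ es → any? λ u → any? λ w → temporalWalk? u es w ×-dec sublist? _≟_ (e ∷ e′ ∷ []) es)
    (λ { (_ , _ , (_ , inc) , _) → increasing⇒length≤m inc })

  source? : Decidable Source
  source? e = all? (ᵉ⇝ᵛ? e)

  sink? : Decidable Sink
  sink? e = all? λ v → ᵛ⇝ᵉ? v e

  divergent? : Decidable Divergent
  divergent? e = source? e ×-dec
    ¬? (any? λ e′ → source? e′ ×-dec ¬? (e′ ≟ e) ×-dec ᵉ⇝ᵉ? e e′)

  divSink? : Decidable DivSink
  divSink? e = sink? e ×-dec all? λ d → divergent? d →-dec ᵉ⇝ᵉ? d e

  convergent? : Decidable Convergent
  convergent? e = divSink? e ×-dec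
    ¬? (any? λ e′ → divSink? e′ ×-dec ¬? (e′ ≟ e) ×-dec ᵉ⇝ᵉ? e′ e)

{-# OPTIONS --safe #-}
-- If both endpoints of an edge f carry source edges with labels larger than
-- label f, then f is redundant: a walk crossing f can, at the endpoint where it
-- meets f, wait for that source edge and reach its target from there.  So, by
-- minimality, every source edge f is the latest source edge top x at one of its
-- endpoints x, and it is so at both endpoints exactly when it is divergent.
-- Every vertex x has a source edge (its earliest edge), so counting the vertices
-- by top x gives n = #source + #divergent.  Following the edges top x upwards
-- leads each vertex to the divergent edge of its tree.  Around a cycle of source
-- edges the labels of top x would be strictly monotone, which is absurd.
-- The upper part is the same argument with time reversed.
module Submission where

open import Defs
open import Data.Fin using (Fin; zero; suc)
open import Data.Fin.Induction using (spo-noetherian)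
open import Data.Fin.Permutation using (↔⇒≡)
open import Data.Fin.Properties using (_≟_; any?; +↔⊎)
open import Data.List using (List; []; _∷_; length; lookup; filter; allFin; _++_)
open import Data.List.Membership.Propositional using (_∈_)
open import Data.List.Membership.Propositional.Properties
  using (∈-lookup; ∈-filter⁺; ∈-filter⁻; ∈-allFin)
open import Data.List.Relation.Binary.Sublist.Propositional
  using (_⊆_; from∈; to∈) renaming (_∷_ to _∷ˢ_; _∷ʳ_ to _∷ʳˢ_)
open import Data.List.Relation.Unary.All as All using (All; []; _∷_)
open import Data.List.Relation.Unary.All.Properties as All using (++⁺)
open import Data.List.Relation.Unary.AllPairs using (AllPairs; []; _∷_)
open import Data.List.Relation.Unary.Any as Any using (here; there; index)
open import Data.List.Relation.Unary.Any.Properties using (lookup-index)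
open import Data.List.Relation.Unary.Linked.Properties using (Linked⇒AllPairs; AllPairs⇒Linked)
open import Data.List.Relation.Unary.Unique.Propositional using (Unique)
open import Data.List.Relation.Unary.Unique.Propositional.Properties using (allFin⁺; filter⁺)
open import Data.Nat using (ℕ; suc; _+_; _≤_; _<_; z≤n; s≤s; _<?_)
open import Data.Nat.Properties
  using (≤-refl; ≤-trans; <-trans; <⇒≤; ≮⇒≥; ≤∧≢⇒<; <-irrefl; n≤1+n; <-cmp)
open import Data.Product using (∃; ∃-syntax; _×_; _,_; proj₁; proj₂)
open import Data.Product.Properties using (,-injective)
open import Data.Sum as Sum using (_⊎_; inj₁; inj₂)
open import Data.Unit using (tt)
open import Function using (_∘_; _$_; case_of_; flip)
open import Function.Bundles using (_⇔_; mk⇔; mk⤖; Equivalence)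
open import Function.Definitions using (Injective; Surjective)
open import Function.Properties.Bijection using (⤖⇒↔)
open import Function.Construct.Composition using (_↔-∘_)
open import Induction.WellFounded using (Acc; acc)
open import Level using (0ℓ)
open import Relation.Binary using (Rel; IsStrictPartialOrder; tri<; tri≈; tri>)
import Relation.Binary as Bin
import Relation.Binary.Construct.Flip.EqAndOrd as Flip
open import Relation.Binary.PropositionalEquality
  using (_≡_; _≢_; refl; sym; trans; cong; subst; isEquivalence; resp₂)
open import Relation.Nullary using (Dec; yes; no; ¬_; contradiction)
open import Relation.Nullary.Decidable using (_×-dec_)
open import Relation.Unary using (Pred; Decidable; U)

module _ {n : ℕ} (G : HappyTemporalGraph n) where
  open HappyTemporalGraph G

  -- Incidence and connectivity in the footprint.

  Incident : Edge → V → Set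
  Incident e x = ∃[ y ] Joins e x y

  incident? : ∀ e x → Dec (Incident e x)
  incident? e x = any? (joins? G e x)

  joins-sym : ∀ {e x y} → Joins e x y → Joins e y x
  joins-sym = Sum.swap

  joins-ends : ∀ e → Joins e (proj₁ (ends e)) (proj₂ (ends e))
  joins-ends e = inj₁ refl

  incidentˡ : ∀ {e x y} → Joins e x y → Incident e x
  incidentˡ j = _ , j

  incidentʳ : ∀ {e x y} → Joins e x y → Incident e y
  incidentʳ j = _ , joins-sym j

  joins⇒≢ : ∀ {e x y} → Joins e x y → x ≢ y
  joins⇒≢ j refl = loopless _ _ j

  incident-endpoint : ∀ {e x y z} → Joins e x y → Incident e z → z ≡ x ⊎ z ≡ y
  incident-endpoint (inj₁ p) (_ , inj₁ q) = inj₁ (proj₁ (,-injective (trans (sym q) p)))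
  incident-endpoint (inj₁ p) (_ , inj₂ q) = inj₂ (proj₂ (,-injective (trans (sym q) p)))
  incident-endpoint (inj₂ p) (_ , inj₁ q) = inj₂ (proj₁ (,-injective (trans (sym q) p)))
  incident-endpoint (inj₂ p) (_ , inj₂ q) = inj₁ (proj₂ (,-injective (trans (sym q) p)))

  joins-functional : ∀ {e x y z} → Joins e x y → Joins e x z → y ≡ z
  joins-functional j k with incident-endpoint j (incidentʳ k)
  ... | inj₁ refl = contradiction k (loopless _ _)
  ... | inj₂ refl = refl

  label-≢ : ∀ {e g x} → Incident e x → Incident g x → e ≢ g → label e ≢ label g
  label-≢ (_ , j) (_ , k) e≢g = happy _ _ (e≢g , _ , _ , _ , j , k)

  connected-trans : ∀ {F u v w} → Connected G F u v → Connected G F v w → Connected G F u w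
  connected-trans {F} (_ , p , fs) (_ , q , gs) = _ , append p q , ++⁺ fs gs
    where
    append : ∀ {u v w es es′} → Walk G u es v → Walk G v es′ w → Walk G u (es ++ es′) w
    append []      q = q
    append (j ∷ p) q = j ∷ append p q

  connected-edge : ∀ {F e u v} → F e → Joins e u v → Connected G F u v
  connected-edge f j = _ , j ∷ [] , f ∷ []

  connected-sym : ∀ {F u v} → Connected G F u v → Connected G F v u
  connected-sym (_ , []    , [])     = _ , [] , []
  connected-sym (_ , j ∷ p , f ∷ fs) =
    connected-trans (connected-sym (_ , p , fs)) (connected-edge f (joins-sym j))

  -- Paths and cycles repeat no edge.

  ∈-walk⇒∈-vertices : ∀ {e es u v x} (w : Walk G u es v) → e ∈ es → Incident e x →
                      x ∈ u ∷ arrivals G w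
  ∈-walk⇒∈-vertices (j ∷ w) (here refl) i with incident-endpoint j i
  ... | inj₁ refl = here refl
  ... | inj₂ refl = there (here refl)
  ∈-walk⇒∈-vertices (j ∷ w) (there e∈) i = there (∈-walk⇒∈-vertices w e∈ i)

  ∉-tabulate : ∀ {es : List Edge} {e} → ¬ e ∈ es → All (e ≢_) es
  ∉-tabulate e∉ = All.tabulate λ { f∈ refl → e∉ f∈ }

  path-unique : ∀ {u es v} (w : Walk G u es v) → Unique (u ∷ arrivals G w) → Unique es
  path-unique []      _         = []
  path-unique (j ∷ w) (u∉ ∷ un) =
    ∉-tabulate (λ e∈ → All.lookup u∉ (∈-walk⇒∈-vertices w e∈ (incidentˡ j)) refl)
    ∷ path-unique w un

  end∈arrivals : ∀ {u e es v} (w : Walk G u (e ∷ es) v) → v ∈ arrivals G w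
  end∈arrivals (_ ∷ [])        = here refl
  end∈arrivals (_ ∷ w@(_ ∷ _)) = there (end∈arrivals w)

  -- Past its first edge a cycle is a path, so only the first edge could recur.
  cycle-unique : ∀ {u es} (w : Walk G u es u) → 3 ≤ length es → Unique (arrivals G w) → Unique es
  cycle-unique (_ ∷ []) (s≤s ()) _
  cycle-unique (_ ∷ _ ∷ []) (s≤s (s≤s ())) _
  cycle-unique (j ∷ w@(j′ ∷ w′@(_ ∷ _))) _ un@(x∉ ∷ y∉ ∷ _) = ∉-tabulate e∉ ∷ path-unique w un
    where
    e∉ : ¬ _ ∈ _
    -- If the first two edges agree, the walk is back at its start after two steps; as a third edge
    -- follows, the start is then arrived at twice.
    e∉ (here refl) = All.lookup y∉ (end∈arrivals w′) (joins-functional j′ (joins-sym j))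
    e∉ (there e∈)  = All.lookup x∉ (∈-walk⇒∈-vertices w′ e∈ (incidentʳ j)) refl

  -- Counting edges and choosing maximal ones.

  module Counting {P : Pred Edge 0ℓ} (P? : Decidable P) where
    chosen : List Edge
    chosen = filter P? (allFin m)

    nth : Fin (# G P?) → Edge
    nth = lookup chosen

    nth-satisfies : ∀ i → P (nth i)
    nth-satisfies i = proj₂ (∈-filter⁻ P? {xs = allFin m} (∈-lookup i))

    nth-injective : ∀ {i j} → nth i ≡ nth j → i ≡ j
    nth-injective = unique⇒lookup-injective G (filter⁺ P? (allFin⁺ m)) _ _

    rank : ∀ {e} → P e → Fin (# G P?)
    rank p = index (∈-filter⁺ P? (∈-allFin _) p)

    nth-rank : ∀ {e} (p : P e) → nth (rank p) ≡ e
    nth-rank p = sym (lookup-index (∈-filter⁺ P? (∈-allFin _) p))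

  module _ {_≺_ : Rel Edge 0ℓ} (≺-spo : IsStrictPartialOrder _≡_ _≺_) (_≺?_ : Bin.Decidable _≺_)
    where

    abstract
      -- A strict order on a finite type is Noetherian, so passing to larger elements of `P` must
      -- stop.
      maximal : ∀ {P : Pred Edge 0ℓ} → Decidable P → ∃ P →
                ∃[ e ] (P e × (∀ g → P g → ¬ e ≺ g))
      maximal {P} P? (e , p) = go p (spo-noetherian ≺-spo e)
        where
        go : ∀ {e} → P e → Acc (flip _≺_) e → ∃[ e ] (P e × (∀ g → P g → ¬ e ≺ g))
        go {e} p (acc rs) with any? (λ g → P? g ×-dec e ≺? g)
        ... | yes (_ , p′ , e≺g) = go p′ (rs e≺g)
        ... | no ∄              = e , p , λ g p′ e≺g → ∄ (g , p′ , e≺g)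

  -- P is the predicate selecting the source (or div-sink) edges, Q that of the
  -- divergent (or convergent) ones, and e ≺ g says that e is earlier (later) than g.
  module Forest
    {_≺_ : Rel Edge 0ℓ} (≺-spo : IsStrictPartialOrder _≡_ _≺_) (_≺?_ : Bin.Decidable _≺_)
    (comparable : ∀ {e g x} → Incident e x → Incident g x → e ≢ g → e ≺ g ⊎ g ≺ e)
    {P Q : Pred Edge 0ℓ} (P? : Decidable P) (Q? : Decidable Q)
    (covered : ∀ x → ∃[ e ] (Incident e x × P e))
    (peaked : ∀ f → ¬ (∀ z → Incident f z → ∃[ g ] (Incident g z × P g × f ≺ g)))
    (Q⇔ : ∀ e → Q e ⇔ (P e × ∀ {x g} → Incident e x → Incident g x → P g → ¬ e ≺ g))
    where

    open IsStrictPartialOrder ≺-spo using () renaming (trans to ≺-trans; irrefl to ≺-irrefl)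
    module 𝑃 = Counting P?
    module 𝑄 = Counting Q?

    -- The top edge at each vertex.

    top-spec : ∀ x → ∃[ e ] ((Incident e x × P e) × (∀ g → Incident g x × P g → ¬ e ≺ g))
    top-spec x = maximal ≺-spo _≺?_ (λ e → incident? e x ×-dec P? e) (covered x)

    top : V → Edge
    top x = proj₁ (top-spec x)

    top-incident : ∀ x → Incident (top x) x
    top-incident x = proj₁ (proj₁ (proj₂ (top-spec x)))

    top-P : ∀ x → P (top x)
    top-P x = proj₂ (proj₁ (proj₂ (top-spec x)))

    -- Edges meeting at `x` are comparable, so a maximal one is the greatest.
    ≺-top : ∀ {g x} → Incident g x → P g → g ≢ top x → g ≺ top x
    ≺-top {g} {x} i p g≢ with comparable i (top-incident x) g≢
    ... | inj₁ g≺ = g≺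
    ... | inj₂ ≺g = contradiction ≺g (proj₂ (proj₂ (top-spec x)) g (i , p))

    ¬top≺ : ∀ {g x} → Incident g x → P g → ¬ top x ≺ g
    ¬top≺ {g} {x} i p = proj₂ (proj₂ (top-spec x)) g (i , p)

    -- Otherwise the top edges of both endpoints lie above `f`, which `peaked` forbids.
    edge-top : ∀ {f x y} → P f → Joins f x y → f ≡ top x ⊎ f ≡ top y
    edge-top {f} {x} {y} p j with f ≟ top x | f ≟ top y
    ... | yes eq | _      = inj₁ eq
    ... | no _   | yes eq = inj₂ eq
    ... | no ≢x  | no ≢y  = contradiction higher (peaked f)
      where
      higher : ∀ z → Incident f z → ∃[ g ] (Incident g z × P g × f ≺ g)
      higher z i with incident-endpoint j i
      ... | inj₁ refl = top z , top-incident z , top-P z , ≺-top i p ≢x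
      ... | inj₂ refl = top z , top-incident z , top-P z , ≺-top i p ≢y

    Q⇒P : ∀ {e} → Q e → P e
    Q⇒P {e} q = proj₁ (Equivalence.to (Q⇔ e) q)

    -- Together with `top⇒Q` this identifies `Q` as the edges that are the top edge of both their
    -- endpoints.
    Q⇒top : ∀ {e x} → Q e → Incident e x → top x ≡ e
    Q⇒top {e} {x} q i with e ≟ top x
    ... | yes eq = sym eq
    ... | no ≢   = contradiction (≺-top i (Q⇒P q) ≢)
                     (proj₂ (Equivalence.to (Q⇔ e) q) i (top-incident x) (top-P x))

    top⇒Q : ∀ {e x y} → Joins e x y → top x ≡ e → top y ≡ e → Q e
    top⇒Q {e} {x} {y} j refl eq = Equivalence.from (Q⇔ e) (top-P x , bound)
      where
      bound : ∀ {z g} → Incident e z → Incident g z → P g → ¬ e ≺ g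
      bound {z} {g} i k p with incident-endpoint j i
      ... | inj₁ refl = ¬top≺ k p
      ... | inj₂ refl = ¬top≺ k p ∘ subst (_≺ g) (sym eq)

    -- Counting the vertices by their top edges.

    -- For `e` in `P` this is an endpoint with top edge `e`, the first one if both qualify; for
    -- other edges the second endpoint is a dummy value.
    owner : Edge → V
    owner e with e ≟ top (proj₁ (ends e))
    ... | yes _ = proj₁ (ends e)
    ... | no  _ = proj₂ (ends e)

    top-owner : ∀ {e} → P e → top (owner e) ≡ e
    top-owner {e} p with e ≟ top (proj₁ (ends e))
    ... | yes eq = sym eq
    ... | no ≢   with edge-top p (joins-ends e)
    ...   | inj₁ eq = contradiction eq ≢
    ...   | inj₂ eq = sym eq

    owner-Q : ∀ {e} → Q e → owner e ≡ proj₁ (ends e)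
    owner-Q {e} q with e ≟ top (proj₁ (ends e))
    ... | yes _ = refl
    ... | no ≢  = contradiction (sym (Q⇒top q (incidentˡ (joins-ends e)))) ≢

    -- An edge of P owns an endpoint whose top edge it is; an edge of Q is the
    -- top edge of both its endpoints and owns the second one as well.
    owned : Fin (# G P?) ⊎ Fin (# G Q?) → V
    owned (inj₁ i) = owner (𝑃.nth i)
    owned (inj₂ i) = proj₂ (ends (𝑄.nth i))

    -- Equal vertices have equal top edges, so `e` would be `e′`, whose owner is its first endpoint
    -- and hence not its second.
    owner-≢ : ∀ {e e′} → P e → Q e′ → owner e ≢ proj₂ (ends e′)
    owner-≢ {e} {e′} p q eq = joins⇒≢ (joins-ends e′)
      (trans (sym (owner-Q q)) (trans (cong owner (sym e≡e′)) eq))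
      where
      e≡e′ : e ≡ e′
      e≡e′ = trans (sym (top-owner p)) (trans (cong top eq) (Q⇒top q (incidentʳ (joins-ends e′))))

    owned-injective : Injective _≡_ _≡_ owned
    owned-injective {inj₁ i} {inj₁ j} eq = cong inj₁ $ 𝑃.nth-injective $
      trans (sym (top-owner (𝑃.nth-satisfies i)))
            (trans (cong top eq) (top-owner (𝑃.nth-satisfies j)))
    owned-injective {inj₁ i} {inj₂ j} eq =
      contradiction eq (owner-≢ (𝑃.nth-satisfies i) (𝑄.nth-satisfies j))
    owned-injective {inj₂ i} {inj₁ j} eq =
      contradiction (sym eq) (owner-≢ (𝑃.nth-satisfies j) (𝑄.nth-satisfies i))
    owned-injective {inj₂ i} {inj₂ j} eq = cong inj₂ $ 𝑄.nth-injective $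
      trans (sym (Q⇒top (𝑄.nth-satisfies i) (incidentʳ (joins-ends _))))
            (trans (cong top eq) (Q⇒top (𝑄.nth-satisfies j) (incidentʳ (joins-ends _))))

    -- The owner of `top x` can differ from `x` only if `x` is the second endpoint and the first has
    -- the same top edge; then `top⇒Q` applies.
    top-owned : ∀ x → owner (top x) ≡ x ⊎ (Q (top x) × proj₂ (ends (top x)) ≡ x)
    top-owned x with top x ≟ top (proj₁ (ends (top x)))
                   | incident-endpoint (joins-ends (top x)) (top-incident x)
    ... | yes _  | inj₁ x≡ = inj₁ (sym x≡)
    ... | yes eq | inj₂ x≡ = inj₂ (top⇒Q (joins-ends _) (sym eq) (cong top (sym x≡)) , sym x≡)
    ... | no ≢   | inj₁ x≡ = contradiction (cong top x≡) ≢
    ... | no _   | inj₂ x≡ = inj₁ (sym x≡)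

    owned-surjective : Surjective _≡_ _≡_ owned
    owned-surjective x with top-owned x
    ... | inj₁ eq       = inj₁ (𝑃.rank (top-P x)) ,
      λ { refl → trans (cong owner (𝑃.nth-rank (top-P x))) eq }
    ... | inj₂ (q , eq) = inj₂ (𝑄.rank q) ,
      λ { refl → trans (cong (proj₂ ∘ ends) (𝑄.nth-rank q)) eq }

    #P+#Q≡n : # G P? + # G Q? ≡ n
    #P+#Q≡n = ↔⇒≡ (⤖⇒↔ (mk⤖ (owned-injective , owned-surjective)) ↔-∘ +↔⊎)

    -- Trees and their roots.

    -- A climb along top edges to an edge of `Q`. Since `go` may also cross an edge of `Q`, climbs
    -- are not unique, but their ends are, by `↝-functional`.
    data _↝_ : V → Edge → Set where
      stop : ∀ {x}     → Q (top x) → x ↝ top x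
      go   : ∀ {x y d} → Joins (top x) x y → y ↝ d → x ↝ d

    -- As long as `top x` is not also the top edge of its other endpoint, stepping there makes the
    -- top edge strictly larger.
    ↝-exists : ∀ x → ∃[ d ] (x ↝ d)
    ↝-exists x = climb x (spo-noetherian ≺-spo (top x))
      where
      climb : ∀ x → Acc (flip _≺_) (top x) → ∃[ d ] (x ↝ d)
      climb x (acc rs) with top-incident x
      ... | y , j with top x ≟ top y
      ...   | yes eq = _ , stop (top⇒Q j refl (sym eq))
      ...   | no  ≢  with climb y (rs (≺-top (incidentʳ j) (top-P x) ≢))
      ...     | d , y↝d = d , go j y↝d

    ↝-Q : ∀ {x d} → x ↝ d → Q d
    ↝-Q (stop q) = q
    ↝-Q (go _ r) = ↝-Q r

    -- An edge of `Q` is the top edge of both its endpoints, so the climb can only go back and forth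
    -- across it.
    ↝-stopped : ∀ {x d} → Q (top x) → x ↝ d → d ≡ top x
    ↝-stopped q (stop _) = refl
    ↝-stopped q (go {x} {y} j r) =
      trans (↝-stopped (subst Q (sym eq) q) r) eq
      where
      eq : top y ≡ top x
      eq = Q⇒top q (incidentʳ j)

    ↝-functional : ∀ {x d d′} → x ↝ d → x ↝ d′ → d ≡ d′
    ↝-functional (stop q) r = sym (↝-stopped q r)
    ↝-functional r@(go _ _) (stop q) = ↝-stopped q r
    ↝-functional (go j r) (go k s) with joins-functional j k
    ... | refl = ↝-functional r s

    -- The first endpoint of `d` serves as meeting point for all vertices that climb to `d`.
    ↝-connected : ∀ {x d} → x ↝ d → Connected G P x (proj₁ (ends d))
    ↝-connected {x} (stop q) with incident-endpoint (joins-ends (top x)) (top-incident x)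
    ... | inj₁ x≡ = subst (Connected G P x) x≡ (_ , [] , [])
    ... | inj₂ x≡ = subst (λ z → Connected G P z (proj₁ (ends (top x)))) (sym x≡)
                      (connected-edge (top-P x) (joins-sym (joins-ends _)))
    ↝-connected {x} (go j r) = connected-trans (connected-edge (top-P x) j) (↝-connected r)

    root : V → Edge
    root x = proj₁ (↝-exists x)

    ↝-root : ∀ x → x ↝ root x
    ↝-root x = proj₂ (↝-exists x)

    -- By `edge-top` the edge is the first step of a climb from one of its endpoints through the
    -- other.
    root-edge : ∀ {f x y} → P f → Joins f x y → root x ≡ root y
    root-edge p j with edge-top p j
    ... | inj₁ refl = ↝-functional (↝-root _) (go j (↝-root _))
    ... | inj₂ refl = ↝-functional (go (joins-sym j) (↝-root _)) (↝-root _)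

    root-connected : ∀ {x y} → Connected G P x y → root x ≡ root y
    root-connected (_ , []    , [])     = refl
    root-connected (_ , j ∷ w , p ∷ ps) = trans (root-edge p j) (root-connected (_ , w , ps))

    tree : V → Fin (# G Q?)
    tree x = 𝑄.rank (↝-Q (↝-root x))

    nth-tree : ∀ x → 𝑄.nth (tree x) ≡ root x
    nth-tree x = 𝑄.nth-rank (↝-Q (↝-root x))

    tree-surjective : Surjective _≡_ _≡_ tree
    tree-surjective i = x , λ { refl → 𝑄.nth-injective (trans (nth-tree x) root-x) }
      where
      d = 𝑄.nth i
      x = proj₁ (ends d)
      top-x : top x ≡ d
      top-x = Q⇒top (𝑄.nth-satisfies i) (incidentˡ (joins-ends d))
      root-x : root x ≡ d
      root-x = trans (↝-stopped (subst Q (sym top-x) (𝑄.nth-satisfies i)) (↝-root x)) top-x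

    tree-component : ∀ u v → (tree u ≡ tree v) ⇔ Connected G P u v
    tree-component u v = mk⇔
      (λ eq → connected-trans (↝-connected (↝-root u))
        (subst (λ d → Connected G P (proj₁ (ends d)) v)
          (trans (sym (nth-tree v)) (trans (cong 𝑄.nth (sym eq)) (nth-tree u)))
          (connected-sym (↝-connected (↝-root v)))))
      (λ c → 𝑄.nth-injective (trans (nth-tree u) (trans (root-connected c) (sym (nth-tree v)))))

    -- Acyclicity.

    -- A first edge other than `top x` is the top edge of its far end `z`, so `top z ≺ top x`. The
    -- rest of the walk avoids that edge, and the argument repeats.
    descends : ∀ {x es y} → Walk G x es y → All P es → Unique (top x ∷ es) →
               es ≡ [] ⊎ top y ≺ top x
    descends []      []       _                       = inj₁ refl
    descends {x} (_∷_ {v = z} j w) (p ∷ ps) ((x≢e ∷ _) ∷ un) with edge-top p j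
    ... | inj₁ e≡x  = contradiction (sym e≡x) x≢e
    ... | inj₂ refl with ≺-top (incidentˡ j) p (x≢e ∘ sym) | descends w ps un
    ...   | z≺x | inj₂ y≺z = inj₂ (≺-trans y≺z z≺x)
    ...   | z≺x | inj₁ refl with w
    ...     | [] = inj₂ z≺x

    ascends : ∀ {x es y} → Walk G x es y → All P es → Unique es →
              es ≡ [] ⊎ top y ∈ es ⊎ (top x ∈ es × top x ≺ top y)
    ascends []      []       _         = inj₁ refl
    ascends {x} {y = y} (_∷_ {v = z} j w) (p ∷ ps) (e∉ ∷ un) with ascends w ps un
    ... | inj₂ (inj₁ y∈) = inj₂ (inj₁ (there y∈))
    ... | inj₂ (inj₂ (z∈ , z≺y)) with edge-top p j
    ...   | inj₂ refl = contradiction refl (All.lookup e∉ z∈)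
    ...   | inj₁ refl = inj₂ (inj₂ (here refl ,
              ≺-trans (≺-top (incidentʳ j) p (All.lookup e∉ z∈)) z≺y))
    ascends {x} (_∷_ {v = z} {e = e} j []) (p ∷ ps) _ | inj₁ refl with e ≟ top z | edge-top p j
    ...   | yes eq | _         = inj₂ (inj₁ (here (sym eq)))
    ...   | no ≢   | inj₂ eq   = contradiction eq ≢
    ...   | no ≢   | inj₁ refl = inj₂ (inj₂ (here refl , ≺-top (incidentʳ j) p ≢))

    -- If the first edge is not `top u`, it is the top edge of the second vertex, and the top edges
    -- fall until `top u` lies below the first edge, which meets `u`. If it is `top u`, it cannot
    -- recur, so the top edges rise, and that of the second vertex lies below the first edge, which
    -- meets that vertex.
    acyclic : ¬ Cycle G P
    acyclic (_ , _ , [] , () , _)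
    acyclic (u , e ∷ es , w₀@(j ∷ w) , 3≤ , un , p ∷ ps)
      with cycle-unique w₀ 3≤ un | e ≟ top u
    ... | un′@(e∉ ∷ _) | no e≢ with edge-top p j
    ...   | inj₁ eq = contradiction eq e≢
    ...   | inj₂ refl with descends w ps un′
    ...     | inj₁ refl = contradiction 3≤ λ { (s≤s ()) }
    ...     | inj₂ u≺e = ¬top≺ (incidentˡ j) p u≺e
    acyclic (u , e ∷ es , w₀@(j ∷ w) , 3≤ , un , p ∷ ps)
        | e∉ ∷ un′ | yes refl with ascends w ps un′
    ...   | inj₁ refl = contradiction 3≤ λ { (s≤s ()) }
    ...   | inj₂ (inj₁ u∈) = All.lookup e∉ u∈ refl
    ...   | inj₂ (inj₂ (v∈ , v≺u)) = ¬top≺ (incidentʳ j) p v≺u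

    isForest : IsForestOfTrees G P (# G Q?)
    isForest = record
      { acyclic         = acyclic
      ; tree            = tree
      ; tree-surjective = tree-surjective
      ; tree-component  = tree-component
      }

  -- Journeys: temporal walks with time windows.

  -- Journey F s u t v: a temporal walk with edges in F from u to v whose
  -- labels lie in the half-open interval [s , t).
  data Journey (F : Pred Edge 0ℓ) : ℕ → V → ℕ → V → Set where
    stay : ∀ {s t u} → s ≤ t → Journey F s u t u
    move : ∀ {s t e u v w} → s ≤ label e → F e → Joins e u v →
           Journey F (suc (label e)) v t w → Journey F s u t w

  infixr 5 _⨟_

  earlier : ∀ {F r s t u v} → r ≤ s → Journey F s u t v → Journey F r u t v
  earlier r≤s (stay s≤t)        = stay (≤-trans r≤s s≤t)
  earlier r≤s (move s≤e f j p) = move (≤-trans r≤s s≤e) f j p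

  _⨟_ : ∀ {F r s t u v w} → Journey F r u s v → Journey F s v t w → Journey F r u t w
  stay r≤s       ⨟ q = earlier r≤s q
  move r≤e f j p ⨟ q = move r≤e f j (p ⨟ q)

  -- If `x` and `y` coincide, the journey just waits there.
  cross : ∀ {e x y} → Incident e x → Incident e y → Journey U (label e) x (suc (label e)) y
  cross {e} (_ , j) i with incident-endpoint j i
  ... | inj₁ refl = stay (n≤1+n (label e))
  ... | inj₂ refl = move ≤-refl tt j (stay ≤-refl)

  duration : ∀ {F s t u v} → Journey F s u t v → s ≤ t
  duration (stay s≤t)        = s≤t
  duration (move s≤e _ _ p) = ≤-trans s≤e (<⇒≤ (duration p))

  avoid-before : ∀ {f s t u v} → t ≤ label f → Journey U s u t v → Journey (delete G f) s u t v
  avoid-before t≤f (stay s≤t) = stay s≤t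
  avoid-before t≤f (move s≤e _ j p) =
    move s≤e (λ { refl → <-irrefl refl (≤-trans (duration p) t≤f) }) j (avoid-before t≤f p)

  avoid-after : ∀ {f s t u v} → label f < s → Journey U s u t v → Journey (delete G f) s u t v
  avoid-after f<s (stay s≤t) = stay s≤t
  avoid-after f<s (move s≤e _ j p) =
    move s≤e (λ { refl → <-irrefl refl (≤-trans f<s s≤e) }) j
      (avoid-after (≤-trans f<s (≤-trans s≤e (n≤1+n _))) p)

  avoid-or-cross : ∀ f {s t u v} → Journey U s u t v → Journey (delete G f) s u t v ⊎
    ∃[ x ] ∃[ y ] (Journey U s u (label f) x × Incident f x ×
                   Incident f y × Journey U (suc (label f)) y t v)
  avoid-or-cross f (stay s≤t) = inj₁ (stay s≤t)
  avoid-or-cross f (move {e = e} s≤e _ j p) with e ≟ f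
  ... | yes refl = inj₂ (_ , _ , stay s≤e , incidentˡ j , incidentʳ j , p)
  ... | no e≢f with avoid-or-cross f p
  ...   | inj₁ q = inj₁ (move s≤e e≢f j q)
  ...   | inj₂ (_ , _ , q , rest) = inj₂ (_ , _ , move s≤e tt j q , rest)

  -- Translation between walks and journeys.

  _<ˡ_ : Rel Edge 0ℓ
  e <ˡ g = label e < label g

  increasing⇒allPairs : ∀ {es} → Increasing G es → AllPairs _<ˡ_ es
  increasing⇒allPairs = Linked⇒AllPairs <-trans

  fromWalk : ∀ {F s u es v} → Walk G u es v → AllPairs _<ˡ_ es →
             All (λ e → s ≤ label e) es → All F es → ∃[ t ] Journey F s u t v
  fromWalk []      _          _          _        = _ , stay ≤-refl
  fromWalk (j ∷ w) (e< ∷ inc) (s≤e ∷ _) (f ∷ fs) with fromWalk w inc e< fs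
  ... | _ , p = _ , move s≤e f j p

  toWalk : ∀ {F s u t v} → Journey F s u t v → ∃[ es ] (Walk G u es v ×
           AllPairs _<ˡ_ es × All (λ e → s ≤ label e) es × All F es)
  toWalk (stay _) = _ , [] , [] , [] , []
  toWalk (move s≤e f j p) with toWalk p
  ... | _ , w , inc , e< , fs =
    _ , j ∷ w , e< ∷ inc , s≤e ∷ All.map (λ e<g → ≤-trans s≤e (<⇒≤ e<g)) e< , f ∷ fs

  -- All labels of the journey are below `label e`, so `e` can be appended.
  toWalkVia : ∀ {F s u e x} → Journey F s u (label e) x → Incident e x →
              ∃[ es ] ∃[ v ] (Walk G u es v × AllPairs _<ˡ_ es ×
                              All (λ e → s ≤ label e) es × e ∈ es)
  toWalkVia (stay s≤e) (_ , j) = _ , _ , j ∷ [] , [] ∷ [] , s≤e ∷ [] , here refl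
  toWalkVia (move s≤e f j p) i with toWalkVia p i
  ... | _ , _ , w , inc , e< , e∈ = _ , _ , j ∷ w , e< ∷ inc ,
    s≤e ∷ All.map (λ e<g → ≤-trans s≤e (<⇒≤ e<g)) e< , there e∈

  splitWalk : ∀ {s u es v e} → Walk G u es v → AllPairs _<ˡ_ es →
              All (λ e → s ≤ label e) es → e ∈ es →
              ∃[ x ] ∃[ y ] ∃[ t ] (Journey U s u (label e) x × Incident e x ×
                                    Incident e y × Journey U (suc (label e)) y t v)
  splitWalk (j ∷ w) (e< ∷ inc) (s≤e ∷ _) (here refl) with fromWalk {F = U} w inc e< (All.universal (λ _ → tt) _)
  ... | _ , p = _ , _ , _ , stay s≤e , incidentˡ j , incidentʳ j , p
  splitWalk (j ∷ w) (e< ∷ inc) (s≤e ∷ _) (there e∈) with splitWalk w inc e< e∈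
  ... | _ , _ , _ , p , rest = _ , _ , _ , move s≤e tt j p , rest

  from-0 : ∀ {es} → All (λ e → 0 ≤ label e) es
  from-0 = All.universal (λ _ → z≤n) _

  𝓡⇒journey : ∀ {F u v} → 𝓡 G F u v → ∃[ t ] Journey F 0 u t v
  𝓡⇒journey (_ , (w , inc) , fs) = fromWalk w (increasing⇒allPairs inc) from-0 fs

  journey⇒𝓡 : ∀ {F s u t v} → Journey F s u t v → 𝓡 G F u v
  journey⇒𝓡 p with toWalk p
  ... | _ , w , inc , _ , fs = _ , (w , AllPairs⇒Linked inc) , fs

  -- The walk may be taken to reach either endpoint of e right after time
  -- label e: depending on the endpoint, e is traversed last or omitted.
  ᵛ⇝ᵉ⇒journey : ∀ {v e z} → _ᵛ⇝ᵉ_ G v e → Incident e z → Journey U 0 v (suc (label e)) z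
  ᵛ⇝ᵉ⇒journey (_ , _ , (w , inc) , e∈) i with splitWalk w (increasing⇒allPairs inc) from-0 e∈
  ... | _ , _ , _ , p , k , _ = p ⨟ cross k i

  ᵉ⇝ᵛ⇒journey : ∀ {e v z} → _ᵉ⇝ᵛ_ G e v → Incident e z → ∃[ t ] Journey U (label e) z t v
  ᵉ⇝ᵛ⇒journey (_ , _ , (w , inc) , e∈) i with splitWalk w (increasing⇒allPairs inc) from-0 e∈
  ... | _ , _ , _ , _ , _ , k , q = _ , cross i k ⨟ q

  journey⇒ᵛ⇝ᵉ : ∀ {v e x} → Journey U 0 v (label e) x → Incident e x → _ᵛ⇝ᵉ_ G v e
  journey⇒ᵛ⇝ᵉ p i with toWalkVia p i
  ... | _ , _ , w , inc , _ , e∈ = _ , _ , (w , AllPairs⇒Linked inc) , e∈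

  journey⇒ᵉ⇝ᵛ : ∀ {e y t v} → Incident e y → Journey U (suc (label e)) y t v → _ᵉ⇝ᵛ_ G e v
  journey⇒ᵉ⇝ᵛ (_ , j) p with toWalk p
  ... | _ , w , inc , e< , _ =
    _ , _ , (joins-sym j ∷ w , AllPairs⇒Linked (e< ∷ inc)) , here refl

  -- Reachability between edges.

  -- The part of a walk strictly between `e` and `e′`: `e` can be prepended and `e′` appended
  -- whichever endpoints `y` and `x` are.
  Follows : Edge → Edge → Set
  Follows e e′ = ∃[ y ] ∃[ x ] (Incident e y × Journey U (suc (label e)) y (label e′) x × Incident e′ x)

  follows⇒⇝ : ∀ {e e′} → Follows e e′ → _ᵉ⇝ᵉ_ G e e′
  follows⇒⇝ (_ , _ , (_ , j) , p , i) with toWalkVia p i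
  ... | _ , _ , w , inc , e< , e∈ = inj₂ (_ , _ , _ ,
    (joins-sym j ∷ w , AllPairs⇒Linked (e< ∷ inc)) , refl ∷ˢ from∈ e∈)

  ⇝⇒follows : ∀ {e e′} → _ᵉ⇝ᵉ_ G e e′ → e ≡ e′ ⊎ Follows e e′
  ⇝⇒follows (inj₁ eq) = inj₁ eq
  ⇝⇒follows {e} {e′} (inj₂ (_ , _ , _ , (w , inc) , sub)) = inj₂ (go w (increasing⇒allPairs inc) sub)
    where
    go : ∀ {u es v} → Walk G u es v → AllPairs _<ˡ_ es →
         (e ∷ e′ ∷ []) ⊆ es → Follows e e′
    go (j ∷ w) (_ ∷ inc) (_ ∷ʳˢ sub) = go w inc sub
    go (j ∷ w) (e< ∷ inc) (refl ∷ˢ sub) with splitWalk w inc e< (to∈ sub)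
    ... | _ , _ , _ , p , i , _ = _ , _ , incidentʳ j , p , i

  -- The first walk may reach `f` at either endpoint and the second may leave from either; `cross`
  -- joins them in all cases.
  ⇝-trans : ∀ {e f g} → _ᵉ⇝ᵉ_ G e f → _ᵉ⇝ᵉ_ G f g → _ᵉ⇝ᵉ_ G e g
  ⇝-trans p q with ⇝⇒follows p | ⇝⇒follows q
  ... | inj₁ refl | _         = q
  ... | inj₂ _    | inj₁ refl = p
  ... | inj₂ (_ , _ , i , p′ , j) | inj₂ (_ , _ , k , q′ , l) =
    follows⇒⇝ (_ , _ , i , p′ ⨟ cross j k ⨟ q′ , l)

  ᵛ⇝ᵉ-trans : ∀ {v e f} → _ᵛ⇝ᵉ_ G v e → _ᵉ⇝ᵉ_ G e f → _ᵛ⇝ᵉ_ G v f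
  ᵛ⇝ᵉ-trans p q with ⇝⇒follows q
  ... | inj₁ refl               = p
  ... | inj₂ (_ , _ , i , q′ , j) = journey⇒ᵛ⇝ᵉ (ᵛ⇝ᵉ⇒journey p i ⨟ q′) j

  ᵉ⇝ᵛ-trans : ∀ {e f v} → _ᵉ⇝ᵉ_ G e f → _ᵉ⇝ᵛ_ G f v → _ᵉ⇝ᵛ_ G e v
  ᵉ⇝ᵛ-trans p q with ⇝⇒follows p
  ... | inj₁ refl               = q
  ... | inj₂ (_ , _ , i , p′ , j) = journey⇒ᵉ⇝ᵛ i (p′ ⨟ proj₂ (ᵉ⇝ᵛ⇒journey q j))

  adjacent-⇝ : ∀ {e g x} → Incident e x → Incident g x → label e < label g → _ᵉ⇝ᵉ_ G e g
  adjacent-⇝ i j e<g = follows⇒⇝ (_ , _ , i , stay e<g , j)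

  adjacent-≤⇒⇝ : ∀ {e g x} → Incident e x → Incident g x → ¬ label g < label e → _ᵉ⇝ᵉ_ G e g
  adjacent-≤⇒⇝ {e} {g} i j ≮ with e ≟ g
  ... | yes eq = inj₁ eq
  ... | no  ≢  = adjacent-⇝ i j (≤∧≢⇒< (≮⇒≥ ≮) (label-≢ i j ≢))

  first-edge : ∀ {F s u t v} → Journey F s u t v → u ≡ v ⊎
               ∃[ g ] ∃[ y ] (Incident g u × s ≤ label g × Incident g y × Journey F (suc (label g)) y t v)
  first-edge (stay _)          = inj₁ refl
  first-edge (move s≤e _ j p) = inj₂ (_ , _ , incidentˡ j , s≤e , incidentʳ j , p)

  last-edge : ∀ {F s u t v} → Journey F s u t v → u ≡ v ⊎
              ∃[ g ] ∃[ x ] (Journey F s u (label g) x × Incident g x × Incident g v × label g < t)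
  last-edge (stay _) = inj₁ refl
  last-edge (move s≤e f j p) with last-edge p
  ... | inj₁ refl = inj₂ (_ , _ , stay s≤e , incidentˡ j , incidentʳ j , duration p)
  ... | inj₂ (_ , _ , q , rest) = inj₂ (_ , _ , move s≤e f j q , rest)

  -- This reduces reachability to adjacency: if `f` is a source edge, so is the edge `g` next to
  -- `e`. `previous-edge` does the same for div-sink edges.
  next-edge : ∀ {e f} → _ᵉ⇝ᵉ_ G e f → e ≢ f → ∃[ g ] ∃[ x ]
              (Incident e x × Incident g x × label e < label g × _ᵉ⇝ᵉ_ G g f)
  next-edge r e≢f with ⇝⇒follows r
  ... | inj₁ eq = contradiction eq e≢f
  ... | inj₂ (_ , _ , i , stay e<f , j)        = _ , _ , i , j , e<f , inj₁ refl
  ... | inj₂ (_ , _ , i , move e<g _ j p , k) =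
    _ , _ , i , incidentˡ j , e<g , follows⇒⇝ (_ , _ , incidentʳ j , p , k)

  previous-edge : ∀ {e f} → _ᵉ⇝ᵉ_ G e f → e ≢ f → ∃[ g ] ∃[ x ]
                  (Incident f x × Incident g x × label g < label f × _ᵉ⇝ᵉ_ G e g)
  previous-edge r e≢f with ⇝⇒follows r
  ... | inj₁ eq = contradiction eq e≢f
  ... | inj₂ (_ , _ , i , p , k) with last-edge p
  ...   | inj₁ refl = _ , _ , k , i , duration p , inj₁ refl
  ...   | inj₂ (_ , _ , q , j , j′ , g<f) = _ , _ , k , j′ , g<f , follows⇒⇝ (_ , _ , i , q , j)

  -- Walks without `f` survive its deletion, so detours for all walks across `f` would preserve the
  -- reachability graph.
  no-detour : Minimal G → ∀ f → ¬ (∀ {x y t u v} → Journey U 0 u (label f) x → Incident f x →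
               Incident f y → Journey U (suc (label f)) y t v → ∃[ r ] Journey (delete G f) 0 u r v)
  no-detour minimal f detour = minimal f
    ( (λ (es , w , _) → es , w , All.universal (λ _ → tt) es)
    , λ r → case avoid-or-cross f (proj₂ (𝓡⇒journey r)) of λ where
        (inj₁ p)                       → journey⇒𝓡 p
        (inj₂ (_ , _ , p , i , k , q)) → journey⇒𝓡 (proj₂ (detour p i k q)))

  <ˡ-isStrictPartialOrder : IsStrictPartialOrder {A = Edge} _≡_ _<ˡ_
  <ˡ-isStrictPartialOrder = record
    { isEquivalence = isEquivalence
    ; irrefl        = λ { refl → <-irrefl refl }
    ; trans         = <-trans
    ; <-resp-≈      = resp₂ _
    }

  _<ˡ?_ : Bin.Decidable _<ˡ_
  e <ˡ? g = label e <? label g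

  comparable : ∀ {e g x} → Incident e x → Incident g x → e ≢ g →
               label e < label g ⊎ label g < label e
  comparable {e} {g} i j ≢ with <-cmp (label e) (label g)
  ... | tri< lt _ _ = inj₁ lt
  ... | tri≈ _ eq _ = contradiction eq (label-≢ i j ≢)
  ... | tri> _ _ gt = inj₂ gt

  -- The lower and the upper part.

  module _ (2≤n : 2 ≤ n) (connected : TemporallyConnected G) (minimal : Minimal G) where

    another : ∀ (v : V) → ∃[ w ] v ≢ w
    another v = case 2≤n of λ { (s≤s (s≤s _)) → other v }
      where
      other : ∀ {k} (v : Fin (suc (suc k))) → ∃[ w ] v ≢ w
      other zero    = suc zero , λ ()
      other (suc _) = zero , λ ()

    incident-exists : ∀ v → ∃[ e ] Incident e v
    incident-exists v with another v
    ... | w , v≢w with first-edge (proj₂ (𝓡⇒journey (connected v w)))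
    ...   | inj₁ eq               = contradiction eq v≢w
    ...   | inj₂ (g , _ , i , _) = g , i

    -- Any walk leaving `v` starts with an edge that the earliest edge at `v` leads to. The flipped
    -- order makes `maximal` pick the earliest edge.
    source-covered : ∀ v → ∃[ e ] (Incident e v × Source G e)
    source-covered v with maximal (Flip.isStrictPartialOrder <ˡ-isStrictPartialOrder) (flip _<ˡ?_)
                            (λ e → incident? e v) (incident-exists v)
    ... | e , i , earliest = e , i , source
      where
      source : Source G e
      source w with first-edge (proj₂ (𝓡⇒journey (connected v w)))
      ... | inj₁ refl = journey⇒ᵉ⇝ᵛ i (stay ≤-refl)
      ... | inj₂ (g , _ , j , _ , k , p) =
        ᵉ⇝ᵛ-trans (adjacent-≤⇒⇝ i j (earliest g j)) (journey⇒ᵉ⇝ᵛ k p)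

    -- Any walk arriving at `v` ends with an edge that leads to the latest edge at `v`. This applies
    -- also to walks from a divergent edge, which reaches `v` as a source edge.
    divSink-covered : ∀ v → ∃[ e ] (Incident e v × DivSink G e)
    divSink-covered v with maximal <ˡ-isStrictPartialOrder _<ˡ?_
                             (λ e → incident? e v) (incident-exists v)
    ... | e , i , latest = e , i , sink , after
      where
      sink : Sink G e
      sink u with last-edge (proj₂ (𝓡⇒journey (connected u v)))
      ... | inj₁ refl = journey⇒ᵛ⇝ᵉ (stay z≤n) i
      ... | inj₂ (g , _ , p , j , k , _) =
        ᵛ⇝ᵉ-trans (journey⇒ᵛ⇝ᵉ p j) (adjacent-≤⇒⇝ k i (latest g k))

      after : ∀ d → Divergent G d → _ᵉ⇝ᵉ_ G d e
      after d (src , _) with src v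
      ... | _ , _ , (w , inc) , d∈ with splitWalk w (increasing⇒allPairs inc) from-0 d∈
      ...   | _ , _ , _ , _ , _ , j , p with last-edge p
      ...     | inj₁ refl = adjacent-≤⇒⇝ j i (latest d j)
      ...     | inj₂ (g , _ , q , k , k′ , _) =
        ⇝-trans (follows⇒⇝ (_ , _ , j , q , k)) (adjacent-≤⇒⇝ k′ i (latest g k′))

    source-peaked : ∀ f →
      ¬ (∀ z → Incident f z → ∃[ g ] (Incident g z × Source G g × label f < label g))
    source-peaked f larger = no-detour minimal f λ {x} {v = v} p i _ _ →
      let (g , j , src , f<g) = larger x i
          (t , q)             = ᵉ⇝ᵛ⇒journey (src v) j
      -- The first leg ends by time `label f` and the last begins at `label g`, which is later, so
      -- neither can contain `f`.
      in t , avoid-before ≤-refl p ⨟ stay (<⇒≤ f<g) ⨟ avoid-after f<g q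

    -- The detour now replaces the beginning of the walk: a sink edge at `y` earlier than `f` brings
    -- `u` to `y` by time `label f`, and the original walk continues from there.
    sink-peaked : ∀ f →
      ¬ (∀ z → Incident f z → ∃[ g ] (Incident g z × DivSink G g × label g < label f))
    sink-peaked f smaller = no-detour minimal f λ {y = y} {u = u} p _ k q →
      let (g , j , (snk , _) , g<f) = smaller y k
          r                         = ᵛ⇝ᵉ⇒journey (snk u) j
      in _ , avoid-before g<f r ⨟ stay (≤-trans g<f (n≤1+n _)) ⨟ avoid-after ≤-refl q

    -- Divergence becomes a condition on adjacent edges, since `next-edge` turns any source edge
    -- reached from `e` into an adjacent later one.
    divergent⇔ : ∀ e → Divergent G e ⇔
      (Source G e × (∀ {x g} → Incident e x → Incident g x → Source G g → ¬ label e < label g))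
    divergent⇔ e = mk⇔
      (λ (src , last) → src , λ {x} {g} i j src′ e<g →
        last (g , src′ , (λ { refl → <-irrefl refl e<g }) , adjacent-⇝ i j e<g))
      (λ (src , top) → src , λ (e′ , src′ , e′≢e , r) →
        let (g , _ , i , j , e<g , r′) = next-edge r (e′≢e ∘ sym)
        in top i j (λ v → ᵉ⇝ᵛ-trans r′ (src′ v)) e<g)

    convergent⇔ : ∀ e → Convergent G e ⇔
      (DivSink G e × (∀ {x g} → Incident e x → Incident g x → DivSink G g → ¬ label g < label e))
    convergent⇔ e = mk⇔
      (λ (snk , first) → snk , λ {x} {g} i j snk′ g<e →
        first (g , snk′ , (λ { refl → <-irrefl refl g<e }) , adjacent-⇝ j i g<e))
      (λ (snk , top) → snk , λ (e′ , (snk′ , div′) , e′≢e , r) →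
        let (g , _ , i , j , g<e , r′) = previous-edge r e′≢e
        in top i j ((λ v → ᵛ⇝ᵉ-trans (snk′ v) r′) , λ d div → ⇝-trans (div′ d div) r′) g<e)

    module Lower = Forest <ˡ-isStrictPartialOrder _<ˡ?_ comparable (source? G) (divergent? G)
      source-covered source-peaked divergent⇔

    -- With the order reversed, `top x` is the earliest div-sink edge at `x`.
    module Upper = Forest (Flip.isStrictPartialOrder <ˡ-isStrictPartialOrder) (flip _<ˡ?_)
      (λ i j ≢ → Sum.swap (comparable i j ≢)) (divSink? G) (convergent? G)
      divSink-covered sink-peaked convergent⇔

lemma3p24 : (n : ℕ) (G : HappyTemporalGraph n) → 2 ≤ n →
    Compressed G → TemporallyConnected G → Minimal G →
    (let k = # G (divergent? G) in
    IsForestOfTrees G (Source G) k × # G (source? G) + k ≡ n)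
    ×
    (let k′ = # G (convergent? G) in
    IsForestOfTrees G (DivSink G) k′ × # G (divSink? G) + k′ ≡ n)
lemma3p24 n G 2≤n _ connected minimal =
  (Lower.isForest G 2≤n connected minimal , Lower.#P+#Q≡n G 2≤n connected minimal) ,
  (Upper.isForest G 2≤n connected minimal , Upper.#P+#Q≡n G 2≤n connected minimal)
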